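{- For all $n\ge2$, the map $\psi$ restricts to a bijection between the set of connected nonnesting chord diagrams of size $n$ and the set of nonnesting chord diagrams of size $n-1$. (In particular, connected nonnesting diagrams lie in the domain of $\psi$.)
   Context: A chord diagram of size $n$ is a perfect matching of $\{1,\dots,2n\}$; chords are ordered pairs $(a,b)$ with $a<b$, $a$ the source and $b$ the sink. For chords $c_1=(a_1,b_1)$, $c_2=(a_2,b_2)$ with $a_1<a_2$: they cross if $a_2<b_1<b_2$, and then $c_2$ is a right neighbor of $c_1$; they form a nesting if $a_2<b_2<b_1$. A diagram is nonnesting if it contains no nesting. A diagram is connected if its intersection graph (chords as vertices, crossings as edges) is connected. A chord is terminal if it has no right neighbors. A diagram is 1-terminal if no chord other than the last one, in the order of sources, is terminal. The map $\psi$ from 1-terminal diagrams of size $n$ to diagrams of size $n-1$ ($n\ge 2$): let $T$ be 1-terminal with chords $c_1<\dots<c_n$ ordered by source. The source-sink group of a chord $c$ consists of the source of $c$ together with the maximal run of consecutive sinks immediately following it (excluding the sink of $c$ itself). Then $\psi(T)$ is obtained from $T$ by (1) moving each source to the end of its source-sink group (all other endpoints keeping their relative order and every source staying paired with its sink), and (2) deleting the terminal chord $c_n$; endpoints are then relabelled order-preservingly. -}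

module Defs where

open import Data.Fin.Base using (Fin; zero; suc; _≤_; _<_; cast)
open import Data.Fin.Properties using (_≟_; _<?_; any?; ≤∧≢⇒<; cast-trans; cast-is-id)
open import Data.List.Base using (List; []; _∷_; length; lookup; filter; allFin)
open import Data.List.Properties using (filter-all; filter-accept; filter-reject; length-tabulate)
open import Data.List.Membership.Propositional using (_∈_)
open import Data.List.Membership.Propositional.Properties
  using (∈-allFin; ∈-filter⁺; ∈-filter⁻; ∈-lookup)
open import Data.List.Relation.Binary.Permutation.Propositional
  using (_↭_; ↭-refl; ↭-sym; ↭-trans; prep; swap; ↭⇒↭ₛ)
open import Data.List.Relation.Binary.Permutation.Propositional.Properties
  using (↭-length; ∈-resp-↭)
import Data.List.Relation.Binary.Permutation.Setoid.Properties as ↭ₛ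
import Data.List.Relation.Unary.All as All
open import Data.List.Relation.Unary.AllPairs using ([]; _∷_)
open import Data.List.Relation.Unary.Any using (here; there; index)
open import Data.List.Relation.Unary.Any.Properties using (lookup-index)
open import Data.List.Relation.Unary.Unique.Propositional using (Unique)
import Data.List.Relation.Unary.Unique.Propositional.Properties as Unique
open import Data.Nat.Base as ℕ using (ℕ; zero; suc; _*_; z≤n; s≤s)
import Data.Nat.Properties as ℕ
open import Data.Product.Base using (Σ; Σ-syntax; ∃; _×_; _,_; proj₁; proj₂)
open import Data.Sum.Base using (_⊎_)
open import Function.Base using (_∘_)
open import Level using (0ℓ)
open import Relation.Binary.Construct.Closure.ReflexiveTransitive using (Star)
open import Relation.Binary.PropositionalEquality
open import Relation.Nullary using (¬_; yes; no; ¬?; contradiction)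
open import Relation.Unary using (Pred; Decidable)

------------------------------------------------------------------------
-- Diagrams

-- The points 1, …, k are represented by Fin k.
record PerfectMatching (k : ℕ) : Set where
  field
    partner         : Fin k → Fin k
    involutive      : ∀ i → partner (partner i) ≡ i
    fixedPointFree  : ∀ i → partner i ≢ i

open PerfectMatching public

Diagram : ℕ → Set
Diagram n = PerfectMatching (2 * n)

-- Two diagrams are the same when they match the same pairs.  (Without
-- function extensionality _≡_ would be too fine.)
infix 4 _≈_
_≈_ : ∀ {k} → PerfectMatching k → PerfectMatching k → Set
D ≈ E = ∀ i → partner D i ≡ partner E i

IsSource : ∀ {k} → PerfectMatching k → Pred (Fin k) 0ℓ
IsSource D i = i < partner D i

isSource? : ∀ {k} (D : PerfectMatching k) → Decidable (IsSource D)
isSource? D i = i <? partner D i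

-- The chord (source , sink) is determined by its source.
record Chord {k} (D : PerfectMatching k) : Set where
  constructor chord
  field
    source   : Fin k
    isSource : IsSource D source

  sink : Fin k
  sink = partner D source

open Chord public

module _ {k} {D : PerfectMatching k} where

  -- RightNeighbor c d: the chords c, d cross, and d is a right neighbor of c.
  RightNeighbor : Chord D → Chord D → Set
  RightNeighbor c d = source c < source d × source d < sink c × sink c < sink d

  Cross : Chord D → Chord D → Set
  Cross c d = RightNeighbor c d ⊎ RightNeighbor d c

  -- source d < sink d holds for every chord d.
  Nest : Chord D → Chord D → Set
  Nest c d = source c < source d × sink d < sink c

  Terminal : Chord D → Set
  Terminal c = ∀ (d : Chord D) → ¬ RightNeighbor c d

  Last : Chord D → Set
  Last c = ∀ (d : Chord D) → source d ≤ source c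

module _ {k} (D : PerfectMatching k) where

  Nonnesting : Set
  Nonnesting = ∀ (c d : Chord D) → ¬ Nest c d

  Connected : Set
  Connected = ∀ (c d : Chord D) → Star Cross c d

  OneTerminal : Set
  OneTerminal = ∀ (c : Chord D) → ¬ Last c → ¬ Terminal c

OneTerminalDiagram : ℕ → Set
OneTerminalDiagram n = Σ[ T ∈ Diagram n ] OneTerminal T

ConnectedNonnestingDiagram : ℕ → Set
ConnectedNonnestingDiagram n = Σ[ T ∈ Diagram n ] Connected T × Nonnesting T

NonnestingDiagram : ℕ → Set
NonnestingDiagram n = Σ[ D ∈ Diagram n ] Nonnesting D

-- Elements of a set of diagrams are compared as diagrams.
infix 4 _≈ˢ_
_≈ˢ_ : ∀ {k} {P : PerfectMatching k → Set} (D E : Σ (PerfectMatching k) P) → Set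
(D , _) ≈ˢ (E , _) = D ≈ E

------------------------------------------------------------------------
-- The last chord

last : ∀ {k} {P : Pred (Fin k) 0ℓ} → Decidable P → ∃ P →
       Σ[ i ∈ Fin k ] P i × (∀ j → P j → j ≤ i)
last {suc k} {P} P? (i , pi) with any? (P? ∘ suc)
... | yes q = let (j , pj , max) = last (P? ∘ suc) q in
  suc j , pj , λ { zero _ → z≤n ; (suc l) pl → s≤s (max l pl) }
last {suc k} {P} P? (zero , p0) | no ¬q =
  zero , p0 , λ { zero _ → z≤n ; (suc l) pl → contradiction (l , pl) ¬q }
last {suc k} {P} P? (suc i , pi) | no ¬q = contradiction (i , pi) ¬q

lastChord : ∀ {k} (T : PerfectMatching (suc k)) → Σ[ c ∈ Chord T ] Last c
lastChord T =
  let (a , a-source , max) =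
        last (isSource? T) (zero , ≤∧≢⇒< z≤n (fixedPointFree T zero ∘ sym))
  in chord a a-source , λ d → max (source d) (isSource d)

------------------------------------------------------------------------
-- Moving the sources.  A reordering of the points of T is given by the
-- list of the points in their new order.

module _ {k} (T : PerfectMatching k) where

  -- The source-sink group of a source s consists of s and the sinks that
  -- follow it, up to the next source or the sink of s.  In a 1-terminal
  -- diagram only the run following the last source can reach the sink of
  -- its own chord; that chord is deleted by ψ, so it does not matter that
  -- the group is cut off there.

  -- carry s xs is the result for s ∷ xs, where s is a source.
  slide : List (Fin k) → List (Fin k)
  carry : Fin k → List (Fin k) → List (Fin k)

  slide []       = []
  slide (x ∷ xs) with isSource? T x
  ... | yes _ = carry x xs
  ... | no  _ = x ∷ slide xs

  carry s []          = s ∷ []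
  carry s (x ∷ xs) with isSource? T x | x ≟ partner T s
  ... | yes _ | _     = s ∷ carry x xs
  ... | no  _ | yes _ = s ∷ x ∷ slide xs
  ... | no  _ | no  _ = x ∷ carry s xs

  slide-↭ : ∀ xs → slide xs ↭ xs
  carry-↭ : ∀ s xs → carry s xs ↭ s ∷ xs

  slide-↭ []       = ↭-refl
  slide-↭ (x ∷ xs) with isSource? T x
  ... | yes _ = carry-↭ x xs
  ... | no  _ = prep x (slide-↭ xs)

  carry-↭ s []          = ↭-refl
  carry-↭ s (x ∷ xs) with isSource? T x | x ≟ partner T s
  ... | yes _ | _     = prep s (carry-↭ x xs)
  ... | no  _ | yes _ = prep s (prep x (slide-↭ xs))
  ... | no  _ | no  _ = ↭-trans (prep x (carry-↭ s xs)) (swap x s ↭-refl)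

  slid : List (Fin k)
  slid = slide (allFin k)

  slid-length : length slid ≡ k
  slid-length = trans (↭-length (slide-↭ (allFin k))) (length-tabulate (λ i → i))

  slid-unique : Unique slid
  slid-unique = ↭ₛ.Unique-resp-↭ (setoid (Fin k))
    (↭⇒↭ₛ (↭-sym (slide-↭ (allFin k)))) (Unique.allFin⁺ k)

  slid-complete : ∀ i → i ∈ slid
  slid-complete i = ∈-resp-↭ (↭-sym (slide-↭ (allFin k))) (∈-allFin i)

------------------------------------------------------------------------
-- Deleting points

module _ {k : ℕ} where

  delete : Fin k → List (Fin k) → List (Fin k)
  delete x = filter (λ y → ¬? (y ≟ x))

  delete-length : ∀ {x xs} → Unique xs → x ∈ xs → suc (length (delete x xs)) ≡ length xs
  delete-length {x} {y ∷ ys} (y∉ys ∷ u) (here refl) =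
    cong suc (trans
      (cong length (filter-reject (λ z → ¬? (z ≟ x)) {x} {ys} (λ x≢x → x≢x refl)))
      (cong length (filter-all (λ z → ¬? (z ≟ x)) (All.map (λ x≢z z≡x → x≢z (sym z≡x)) y∉ys))))
  delete-length {x} {y ∷ ys} (y∉ys ∷ u) (there x∈ys) =
    cong suc (trans
      (cong length (filter-accept (λ z → ¬? (z ≟ x)) {y} {ys} (All.lookup y∉ys x∈ys)))
      (delete-length u x∈ys))

  delete-unique : ∀ x {xs} → Unique xs → Unique (delete x xs)
  delete-unique x = Unique.filter⁺ (λ y → ¬? (y ≟ x))

  ∈-delete⁺ : ∀ {x y xs} → y ∈ xs → y ≢ x → y ∈ delete x xs
  ∈-delete⁺ {x} = ∈-filter⁺ (λ y → ¬? (y ≟ x))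

  ∈-delete⁻ : ∀ {x y} xs → y ∈ delete x xs → y ∈ xs × y ≢ x
  ∈-delete⁻ {x} xs = ∈-filter⁻ (λ y → ¬? (y ≟ x)) {xs = xs}

------------------------------------------------------------------------
-- Relabelling: the point at position i of the list is renamed to i.

lookup-injective : ∀ {A : Set} {xs : List A} → Unique xs →
                   ∀ i j → lookup xs i ≡ lookup xs j → i ≡ j
lookup-injective (x∉xs ∷ u) zero    zero    eq = refl
lookup-injective (x∉xs ∷ u) zero    (suc j) eq = contradiction eq (All.lookup x∉xs (∈-lookup j))
lookup-injective (x∉xs ∷ u) (suc i) zero    eq = contradiction (sym eq) (All.lookup x∉xs (∈-lookup i))
lookup-injective (x∉xs ∷ u) (suc i) (suc j) eq = cong suc (lookup-injective u i j eq)

module _ {k m} (T : PerfectMatching k) (xs : List (Fin k)) (len : length xs ≡ m)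
         (unique : Unique xs) (closed : ∀ {x} → x ∈ xs → partner T x ∈ xs) where

  oldLabel : Fin m → Fin k
  oldLabel i = lookup xs (cast (sym len) i)

  newLabel : ∀ {x} → x ∈ xs → Fin m
  newLabel x∈xs = cast len (index x∈xs)

  old-new : ∀ {x} (x∈xs : x ∈ xs) → oldLabel (newLabel x∈xs) ≡ x
  old-new x∈xs = trans
    (cong (lookup xs) (trans (cast-trans len (sym len) _) (cast-is-id _ _)))
    (sym (lookup-index x∈xs))

  old-injective : ∀ {i j} → oldLabel i ≡ oldLabel j → i ≡ j
  old-injective {i} {j} eq = trans (sym (cast-cast i)) (trans
    (cong (cast len) (lookup-injective unique _ _ eq)) (cast-cast j))
    where
    cast-cast : ∀ i → cast len (cast (sym len) i) ≡ i
    cast-cast i = trans (cast-trans (sym len) len i) (cast-is-id _ i)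

  newPartner : Fin m → Fin m
  newPartner i = newLabel (closed (∈-lookup (cast (sym len) i)))

  old-newPartner : ∀ i → oldLabel (newPartner i) ≡ partner T (oldLabel i)
  old-newPartner i = old-new (closed (∈-lookup (cast (sym len) i)))

  relabel : PerfectMatching m
  relabel = record
    { partner        = newPartner
    ; involutive     = λ i → old-injective (trans (old-newPartner (newPartner i))
                         (trans (cong (partner T) (old-newPartner i)) (involutive T _)))
    ; fixedPointFree = λ i eq → fixedPointFree T (oldLabel i)
                         (trans (sym (old-newPartner i)) (cong oldLabel eq))
    }

------------------------------------------------------------------------
-- The map ψ

module _ (n : ℕ) (T : Diagram (suc n)) where

  private
    a b : Fin (2 * suc n)
    a = source (proj₁ (lastChord T))
    b = partner T a

  remaining : List (Fin (2 * suc n))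
  remaining = delete b (delete a (slid T))

  remaining-length : length remaining ≡ 2 * n
  remaining-length = ℕ.suc-injective (ℕ.suc-injective (begin
    suc (suc (length remaining))
      ≡⟨ cong suc (delete-length (delete-unique a (slid-unique T))
           (∈-delete⁺ (slid-complete T b) (fixedPointFree T a))) ⟩
    suc (length (delete a (slid T)))
      ≡⟨ delete-length (slid-unique T) (slid-complete T a) ⟩
    length (slid T)
      ≡⟨ slid-length T ⟩
    2 * suc n
      ≡⟨ ℕ.*-suc 2 n ⟩
    suc (suc (2 * n)) ∎))
    where open ≡-Reasoning

  remaining-unique : Unique remaining
  remaining-unique = delete-unique b (delete-unique a (slid-unique T))

  remaining-closed : ∀ {x} → x ∈ remaining → partner T x ∈ remaining
  remaining-closed {x} x∈ =
    let (x∈′ , x≢b) = ∈-delete⁻ (delete a (slid T)) x∈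
        (_   , x≢a) = ∈-delete⁻ (slid T) x∈′
    in ∈-delete⁺ (∈-delete⁺ (slid-complete T _)
         (λ eq → x≢b (trans (sym (involutive T x)) (cong (partner T) eq))))
         (λ eq → x≢a (trans (sym (involutive T x)) (trans (cong (partner T) eq) (involutive T a))))

ψ : ∀ n → OneTerminalDiagram (suc n) → Diagram n
ψ n (T , _) = relabel T (remaining n T) (remaining-length n T)
                (remaining-unique n T) (remaining-closed n T)

{-# OPTIONS --safe #-}

-- A nonnesting diagram is determined by which of its points are sources.
-- Write U for a source and D for a sink: the word of a connected nonnesting
-- diagram is U D^k₁ U D^k₂ … U D^kₙ, and ψ turns it into
-- D^k₁ U D^k₂ … U D^(kₙ-1), that is, ψ deletes the first and the last letter.
-- Nonnesting diagrams being determined by their words, ψ is injective.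
-- Conversely, adding a first source and a last sink to a nonnesting diagram and
-- rematching in the order of the endpoints pairs each sink with the source
-- that precedes its old partner, so that consecutive chords cross.

module Submission where

open import Defs
open import Data.Empty using (⊥)
open import Data.Fin.Base using (Fin; zero; suc; _<_; toℕ; inject₁; fromℕ)
open import Data.Fin.Induction using (<-wellFounded; <-weakInduction)
open import Data.Fin.Properties
  using (<-cmp; <-trans; <-asym; <-irrefl; ≤∧≢⇒<; toℕ-cast; toℕ-injective; toℕ-inject₁; toℕ-fromℕ; toℕ<n;
    ≤fromℕ; fromℕ≢inject₁; inject₁-injective; suc-injective; _≟_; _<?_)
open import Data.Fin.Relation.Unary.Top using (View; view; view-fromℕ; view-inject₁; ‵fromℕ; ‵inject₁)
open import Data.List.Base using (List; []; _∷_; length; lookup; filter; allFin; tabulate)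
open import Data.List.Membership.Propositional using (_∈_)
open import Data.List.Membership.Propositional.Properties
  using (∈-allFin; ∈-filter⁺; ∈-filter⁻; ∈-lookup)
open import Data.List.Properties using (filter-accept; filter-reject)
open import Data.List.Relation.Binary.Permutation.Propositional using (↭-sym; prep)
open import Data.List.Relation.Binary.Permutation.Propositional.Properties using (All-resp-↭)
open import Data.List.Relation.Binary.Prefix.Heterogeneous using (Prefix; []; _∷_)
open import Data.List.Relation.Unary.All as All using (All; []; _∷_)
open import Data.List.Relation.Unary.AllPairs using (AllPairs; []; _∷_)
import Data.List.Relation.Unary.AllPairs.Properties as AllPairs
open import Data.List.Relation.Unary.Any using (here; there; index)
open import Data.List.Relation.Unary.Any.Properties using (lookup-index)
open import Data.List.Relation.Unary.Unique.Propositional using (Unique)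
open import Data.Nat.Base as ℕ using (ℕ; suc; _≤_; _*_; z≤n; s≤s; z<s)
import Data.Nat.Properties as ℕ
open import Data.Product.Base using (Σ-syntax; ∃-syntax; _×_; _,_; proj₁; proj₂)
open import Data.Sum.Base using (_⊎_; inj₁; inj₂; swap)
open import Function.Base using (_∘_; case_of_)
open import Function.Bundles using (_⇔_; mk⇔; Equivalence)
open import Function.Structures using (IsBijection)
import Function.Properties.Equivalence as ⇔
open import Induction.WellFounded using (Acc; acc)
open import Relation.Binary.Construct.Closure.ReflexiveTransitive using (Star; ε; _◅_; _◅◅_; reverse)
open import Level using (0ℓ)
open import Relation.Binary.Definitions using (Tri; tri<; tri≈; tri>)
open import Relation.Binary.PropositionalEquality
open import Relation.Binary.Structures using (IsEquivalence)
open import Relation.Nullary using (¬_; yes; no; ¬?; contradiction)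
open import Relation.Unary using (Pred; Decidable)

open Equivalence using (to; from)

-- Sources, sinks and partners

partner-injective : ∀ {k} (D : PerfectMatching k) {i j} → partner D i ≡ partner D j → i ≡ j
partner-injective D {i} {j} eq =
  trans (sym (involutive D i)) (trans (cong (partner D) eq) (involutive D j))

partner-of-source : ∀ {k} (D : PerfectMatching k) {i} → IsSource D i → ¬ IsSource D (partner D i)
partner-of-source D {i} i<pi pi<ppi =
  <-asym i<pi (subst (partner D i <_) (involutive D i) pi<ppi)

partner-of-sink : ∀ {k} (D : PerfectMatching k) {i} → ¬ IsSource D i → IsSource D (partner D i)
partner-of-sink D {i} ¬src with <-cmp i (partner D i)
... | tri< i<p _ _ = contradiction i<p ¬src
... | tri≈ _ i≡p _ = contradiction (sym i≡p) (fixedPointFree D i)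
... | tri> _ _ p<i = subst (partner D i <_) (sym (involutive D i)) p<i

sinks-increasing : ∀ {k} (D : PerfectMatching k) → Nonnesting D →
  ∀ {i j} → IsSource D i → IsSource D j → i < j → partner D i < partner D j
sinks-increasing D nonnesting {i} {j} si sj i<j with <-cmp (partner D i) (partner D j)
... | tri< pi<pj _ _ = pi<pj
... | tri≈ _ pi≡pj _ = contradiction i<j (<-irrefl (partner-injective D pi≡pj))
... | tri> _ _ pj<pi = contradiction (i<j , pj<pi) (nonnesting (chord i si) (chord j sj))

-- The word determines a nonnesting diagram

SameSources : ∀ {k} (D E : PerfectMatching k) → Set
SameSources D E = ∀ i → IsSource D i ⇔ IsSource E i

module _ {k : ℕ} where

  ≈⇒SameSources : ∀ {D E : PerfectMatching k} → D ≈ E → SameSources D E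
  ≈⇒SameSources D≈E i = mk⇔ (subst (i <_) (D≈E i)) (subst (i <_) (sym (D≈E i)))

  -- Let `y` be the sink that `D` gives to `i`. It is a sink in `E` too, of some source `x`. If
  -- `x < i`, agreement makes `y` the sink of both `x` and `i` in `D`; if `x` is `i`, the two sinks
  -- of `i` coincide; if `i < x`, the chord from `x` to `y` is nested in that of `i` in `E`.
  sink-minimal : ∀ {D E : PerfectMatching k} → Nonnesting E → SameSources D E →
    ∀ {i} → IsSource D i → (∀ {j} → j < i → IsSource D j → partner D j ≡ partner E j) →
    ¬ (partner D i < partner E i)
  sink-minimal {D} {E} nonnesting same {i} si agree pDi<pEi = cases (<-cmp x i)
    where
    y x : Fin k
    y = partner D i
    x = partner E y

    x-source : IsSource E x
    x-source = partner-of-sink E (partner-of-source D si ∘ from (same y))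

    cases : Tri (x < i) (x ≡ i) (i < x) → ⊥
    cases (tri< x<i _ _) = <-irrefl
      (partner-injective D (trans (agree x<i (from (same x) x-source)) (involutive E y))) x<i
    cases (tri≈ _ x≡i _) = <-irrefl
      (trans (sym (involutive E y)) (cong (partner E) x≡i)) pDi<pEi
    cases (tri> _ _ i<x) = nonnesting (chord i (to (same i) si)) (chord x x-source)
      (i<x , subst (_< partner E i) (sym (involutive E y)) pDi<pEi)

  -- Induction on the sources from left to right: once the earlier ones agree, `sink-minimal`,
  -- applied in both directions, lets neither sink come before the other.
  nonnesting-determined : ∀ {D E : PerfectMatching k} → Nonnesting D → Nonnesting E →
    SameSources D E → D ≈ E
  nonnesting-determined {D} {E} nonnestingD nonnestingE same = agree
    where
    agree-source : ∀ i → Acc _<_ i → IsSource D i → partner D i ≡ partner E i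
    agree-source i (acc rec) si with <-cmp (partner D i) (partner E i)
    ... | tri≈ _ eq _ = eq
    ... | tri< lt _ _ = contradiction lt
      (sink-minimal {D} {E} nonnestingE same si (λ {j} j<i → agree-source j (rec j<i)))
    ... | tri> _ _ gt = contradiction gt
      (sink-minimal {E} {D} nonnestingD (⇔.sym ∘ same) (to (same i) si)
        (λ {j} j<i sj → sym (agree-source j (rec j<i) (from (same j) sj))))

    agree : ∀ i → partner D i ≡ partner E i
    agree i with isSource? D i
    ... | yes si = agree-source i (<-wellFounded i) si
    -- A sink is handled through its source in `D`, where agreement is already known.
    ... | no ¬si = sym (trans (cong (partner E) (sym i≡)) (involutive E _))
      where
      i≡ : partner E (partner D i) ≡ i
      i≡ = trans (sym (agree-source _ (<-wellFounded _) (partner-of-sink D ¬si))) (involutive D i)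

-- Chords whose source is at most that of a terminal chord c end at or before
-- the sink of c, and the other chords start after it: nothing crosses over.
connected⇒oneTerminal : ∀ {k} (T : PerfectMatching k) → Connected T → Nonnesting T → OneTerminal T
connected⇒oneTerminal T connected nonnesting c ¬last terminal =
  ¬last (λ d → reachable (connected c d) ℕ.≤-refl)
  where
  source≤ : Chord T → Set
  source≤ d = toℕ (source d) ≤ toℕ (source c)

  sink≤ : ∀ d → source≤ d → toℕ (sink d) ≤ toℕ (sink c)
  sink≤ d d≤c with source d ≟ source c
  ... | yes eq = ℕ.≤-reflexive (cong (toℕ ∘ partner T) eq)
  ... | no neq = ℕ.<⇒≤ (sinks-increasing T nonnesting (isSource d) (isSource c) (≤∧≢⇒< d≤c neq))

  step : ∀ d e → source≤ d → Cross d e → source≤ e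
  step d e d≤c (inj₂ (e<d , _)) = ℕ.≤-trans (ℕ.<⇒≤ e<d) d≤c
  step d e d≤c (inj₁ (_ , e<sd , _)) with source c <? source e
  ... | no c≮e = ℕ.≮⇒≥ c≮e
  ... | yes c<e = contradiction
    (c<e , ℕ.<-≤-trans e<sd (sink≤ d d≤c) , sinks-increasing T nonnesting (isSource c) (isSource e) c<e)
    (terminal e)

  reachable : ∀ {d e} → Star Cross d e → source≤ d → source≤ e
  reachable ε d≤c = d≤c
  reachable (_◅_ {d} {e} cross path) d≤c = reachable path (step d e d≤c cross)

-- Sliding and relabelling

AllPairs-lookup : ∀ {A : Set} {R : A → A → Set} {xs} → AllPairs R xs →
  ∀ {i j} → i < j → R (lookup xs i) (lookup xs j)
AllPairs-lookup (rs ∷ _)  {zero}  {suc j} _         = All.lookup rs (∈-lookup j)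
AllPairs-lookup (_ ∷ rss) {suc i} {suc j} (s≤s i<j) = AllPairs-lookup rss i<j

allFin-increasing : ∀ k → AllPairs _<_ (allFin k)
allFin-increasing k = AllPairs.tabulate⁺-< (λ i<j → i<j)

module _ {k : ℕ} (T : PerfectMatching k) where

  -- Sliding only moves sources past sinks, never past their own.
  Slid : Fin k → Fin k → Set
  Slid x y = x < y ⊎ (¬ IsSource T x × IsSource T y × x ≢ partner T y)

  -- Each point output precedes a permutation of the points still to come, so its relations to them
  -- can be read off the increasing input.
  slide-Slid : ∀ {xs} → AllPairs _<_ xs → AllPairs Slid (slide T xs)
  carry-Slid : ∀ {s xs} → IsSource T s → AllPairs _<_ (s ∷ xs) → AllPairs Slid (carry T s xs)

  slide-Slid [] = []
  slide-Slid {x ∷ xs} (x< ∷ <s) with isSource? T x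
  ... | yes sx = carry-Slid sx (x< ∷ <s)
  ... | no _   = All-resp-↭ (↭-sym (slide-↭ T xs)) (All.map inj₁ x<) ∷ slide-Slid <s

  carry-Slid {s} {[]} ss _ = [] ∷ []
  carry-Slid {s} {x ∷ xs} ss (s<@(_ ∷ s<xs) ∷ <s@(x<xs ∷ xs<)) with isSource? T x | x ≟ partner T s
  ... | yes sx | _      =
    All-resp-↭ (↭-sym (carry-↭ T x xs)) (All.map inj₁ s<) ∷ carry-Slid sx <s
  ... | no _   | yes _  =
    All.map inj₁ (All-resp-↭ (↭-sym (prep x (slide-↭ T xs))) s<)
    ∷ All-resp-↭ (↭-sym (slide-↭ T xs)) (All.map inj₁ x<xs) ∷ slide-Slid xs<
  -- The only source of inversions: the sink `x` is output ahead of the carried source `s`, whose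
  -- own sink it is not.
  ... | no ¬sx | no x≢ps =
    All-resp-↭ (↭-sym (carry-↭ T s xs)) (inj₂ (¬sx , ss , x≢ps) ∷ All.map inj₁ x<xs)
    ∷ carry-Slid ss (s<xs ∷ xs<)

module _ {k m : ℕ} (T : PerfectMatching k) (xs : List (Fin k)) (len : length xs ≡ m)
         (unique : Unique xs) (closed : ∀ {x} → x ∈ xs → partner T x ∈ xs)
         (slid-xs : AllPairs (Slid T) xs) where

  private
    R : PerfectMatching m
    R = relabel T xs len unique closed

    old : Fin m → Fin k
    old = oldLabel T xs len unique closed

    old-partner : ∀ i → old (partner R i) ≡ partner T (old i)
    old-partner = old-newPartner T xs len unique closed

    old-Slid : ∀ {i j} → i < j → Slid T (old i) (old j)
    old-Slid {i} {j} i<j = AllPairs-lookup slid-xs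
      (subst₂ ℕ._<_ (sym (toℕ-cast _ i)) (sym (toℕ-cast _ j)) i<j)

  -- The two ends of a chord are never exchanged: the second alternative of `Slid` excludes a source
  -- and its own sink.
  relabel-source : ∀ i → IsSource R i ⇔ IsSource T (old i)
  relabel-source i = mk⇔ forth back
    where
    forth : IsSource R i → IsSource T (old i)
    forth i<p with subst (Slid T (old i)) (old-partner i) (old-Slid i<p)
    ... | inj₁ lt = lt
    ... | inj₂ (_ , _ , neq) = contradiction (sym (involutive T (old i))) neq

    back : IsSource T (old i) → IsSource R i
    back src with isSource? R i
    ... | yes i<p = i<p
    ... | no ¬i<p with subst₂ (Slid T) (old-partner i) (cong old (involutive R i))
                         (old-Slid (partner-of-sink R ¬i<p))
    ...   | inj₁ lt = contradiction lt (<-asym src)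
    ...   | inj₂ (_ , _ , neq) = contradiction refl neq

  -- A nesting compares source with source and sink with sink, whereas `Slid` inverts only a sink
  -- and a source. So a nesting of `R` comes from one of `T`.
  relabel-nonnesting : Nonnesting T → Nonnesting R
  relabel-nonnesting nonnesting (chord i si) (chord j sj) (i<j , pj<pi) =
    nonnesting (chord (old i) oi) (chord (old j) oj) (old-i<j , old-pj<pi)
    where
    oi = to (relabel-source i) si
    oj = to (relabel-source j) sj

    old-i<j : old i < old j
    old-i<j with old-Slid i<j
    ... | inj₁ lt = lt
    ... | inj₂ (¬oi , _) = contradiction oi ¬oi

    old-pj<pi : partner T (old j) < partner T (old i)
    old-pj<pi with subst₂ (Slid T) (old-partner j) (old-partner i) (old-Slid pj<pi)
    ... | inj₁ lt = lt
    ... | inj₂ (_ , spi , _) = contradiction spi (partner-of-source T oi)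

-- The word of ψ T

-- For l = k + 2 this says that the word of D is that of T without its first
-- and last letters.
Extends : ∀ {k l} → PerfectMatching l → PerfectMatching k → Set
Extends T D = ∀ i j → toℕ j ≡ suc (toℕ i) → IsSource T j ⇔ IsSource D i

-- A `Prefix`, because the points of `T` after the first outnumber the remaining points by one: the
-- final sink has no counterpart.
Prefix-tabulate : ∀ {A B : Set} {R : A → B → Set} {m} {f : Fin m → B} {xs} → Prefix R xs (tabulate f) →
  ∀ i j → toℕ i ≡ toℕ j → R (lookup xs i) (f j)
Prefix-tabulate (r ∷ _)  zero    zero    _  = r
Prefix-tabulate (_ ∷ rs) (suc i) (suc j) eq = Prefix-tabulate rs i j (ℕ.suc-injective eq)

slide-source : ∀ {k} (T : PerfectMatching k) {x} xs → IsSource T x → slide T (x ∷ xs) ≡ carry T x xs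
slide-source T {x} xs sx with isSource? T x
... | yes _  = refl
... | no ¬sx = contradiction sx ¬sx

module _ {k : ℕ} (T : PerfectMatching k) (oneTerminal : OneTerminal T) (nonnesting : Nonnesting T)
         (c : Chord T) (c-last : Last c) where

  private
    strip : List (Fin k) → List (Fin k)
    strip xs = delete (sink c) (delete (source c) xs)

    strip-keep : ∀ {x} xs → x ≢ source c → x ≢ sink c → strip (x ∷ xs) ≡ x ∷ strip xs
    strip-keep xs x≢a x≢b = trans
      (cong (delete (sink c)) (filter-accept (λ y → ¬? (y ≟ source c)) x≢a))
      (filter-accept (λ y → ¬? (y ≟ sink c)) x≢b)

    strip-chord : strip (source c ∷ sink c ∷ []) ≡ []
    strip-chord = trans
      (cong (delete (sink c)) (trans
        (filter-reject (λ y → ¬? (y ≟ source c)) (λ a≢a → a≢a refl))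
        (filter-accept (λ y → ¬? (y ≟ source c)) (fixedPointFree T (source c)))))
      (filter-reject (λ y → ¬? (y ≟ sink c)) (λ b≢b → b≢b refl))

    SameKind : Fin k → Fin k → Set
    SameKind x y = IsSource T x ⇔ IsSource T y

    -- xs is what remains of the points after s once some sinks, all before xs
    -- and none the partner of s, have been passed by s.
    Remaining : Fin k → List (Fin k) → Set
    Remaining s xs = ∀ (y : Fin k) → s < y →
      y ∈ xs ⊎ (¬ IsSource T y × y ≢ partner T s × All (y <_) xs)

    source∈ : ∀ s {xs y} → Remaining s xs → IsSource T y → s < y → y ∈ xs
    source∈ s {y = y} remains sy s<y with remains y s<y
    ... | inj₁ y∈xs      = y∈xs
    ... | inj₂ (¬sy , _) = contradiction sy ¬sy

    ¬before-head : ∀ {x y : Fin k} {xs} → All (x <_) xs → y ∈ x ∷ xs → ¬ y < x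
    ¬before-head x<xs (here refl)  = <-irrefl refl
    ¬before-head x<xs (there y∈xs) = <-asym (All.lookup x<xs y∈xs)

    -- A source beyond `sink c` would follow the last source; a sink beyond it would belong to an
    -- earlier chord, which nonnesting forces to end earlier.
    ends-at-sink : ∀ {x : Fin k} → ¬ sink c < x
    ends-at-sink {x} b<x with isSource? T x
    ... | yes sx = ℕ.<⇒≱ (<-trans (isSource c) b<x) (c-last (chord x sx))
    ... | no ¬sx = <-asym b<x (subst (_< sink c) (involutive T x)
      (sinks-increasing T nonnesting spx (isSource c) (≤∧≢⇒< (c-last (chord _ spx)) px≢a)))
      where
      spx = partner-of-sink T ¬sx

      px≢a : partner T x ≢ source c
      px≢a eq = <-irrefl (trans (cong (partner T) (sym eq)) (involutive T x)) b<x

    -- The source of a right neighbor of `s` would lie between `s` and `x`. Only sinks have been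
    -- passed, so it would still be in `x ∷ xs`, which starts at `x`. Hence `s` is terminal, and
    -- 1-terminality makes it last.
    terminal⇒c : ∀ {s x xs} → IsSource T s → x ≡ partner T s → All (x <_) xs →
      Remaining s (x ∷ xs) → s ≡ source c
    terminal⇒c {s} ss refl x<xs remains with s ≟ source c
    ... | yes s≡a = s≡a
    ... | no s≢a = contradiction
      (λ { (chord y sy) (s<y , y<x , _) → ¬before-head x<xs (source∈ s remains sy s<y) y<x })
      (oneTerminal (chord s ss)
        (λ s-last → s≢a (toℕ-injective (ℕ.≤-antisym (c-last (chord s ss)) (s-last c)))))

  -- Each source takes the place of the next one, so that the kinds of the
  -- points are those of the list without its first source.
  carry-prefix : ∀ {s xs} → IsSource T s → AllPairs _<_ (s ∷ xs) → Remaining s xs →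
    Prefix SameKind (strip (carry T s xs)) xs
  -- The list cannot run out here: the sink of `s` lies after `s` and is not among the passed sinks.
  carry-prefix {s} {[]} ss _ remains with remains _ ss
  ... | inj₂ (_ , ps≢ps , _) = contradiction refl ps≢ps
  carry-prefix {s} {x ∷ xs} ss ((s<x ∷ s<xs) ∷ (x<xs ∷ xs<)) remains
    with isSource? T x | x ≟ partner T s
  -- The output `s` stands opposite the next source `x`, and `strip` keeps it because a source
  -- follows it.
  ... | yes sx | _ = subst (λ zs → Prefix SameKind zs (x ∷ xs))
    (sym (strip-keep (carry T x xs) s≢a s≢b))
    (mk⇔ (λ _ → sx) (λ _ → ss) ∷ carry-prefix sx (x<xs ∷ xs<) remains′)
    where
    s≢a : s ≢ source c
    s≢a refl = ℕ.<⇒≱ s<x (c-last (chord x sx))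

    s≢b : s ≢ sink c
    s≢b refl = partner-of-source T (isSource c) ss

    remains′ : Remaining x xs
    remains′ y x<y with remains y (<-trans s<x x<y)
    ... | inj₁ (here refl)          = contradiction x<y (<-irrefl refl)
    ... | inj₁ (there y∈xs)         = inj₁ y∈xs
    ... | inj₂ (_ , _ , y<x ∷ _)    = contradiction y<x (<-asym x<y)
  -- The carried chord is `c`, so `x` is the final point and `xs` is empty. Both ends of `c` are
  -- deleted, and the prefix stops just short of `x`.
  ... | no _ | yes x≡ps with terminal⇒c ss x≡ps x<xs remains | x≡ps | xs | x<xs
  ...   | refl | refl | []    | _       = subst (λ zs → Prefix SameKind zs (x ∷ [])) (sym strip-chord) []
  ...   | refl | refl | _ ∷ _ | b<z ∷ _ = contradiction b<z ends-at-sink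
  carry-prefix {s} {x ∷ xs} ss ((s<x ∷ s<xs) ∷ (x<xs ∷ xs<)) remains
      | no ¬sx | no x≢ps = subst (λ zs → Prefix SameKind zs (x ∷ xs))
    (sym (strip-keep (carry T s xs) x≢a x≢b))
    (⇔.refl ∷ carry-prefix ss (s<xs ∷ xs<) remains′)
    where
    x≢a : x ≢ source c
    x≢a refl = ¬sx (isSource c)

    -- Otherwise the source of `c` would come after `s` and, not being passed, would be in `x ∷ xs`
    -- although it is smaller than `x`.
    x≢b : x ≢ sink c
    x≢b refl = ¬before-head x<xs (source∈ s remains (isSource c) s<a) (isSource c)
      where
      s<a : s < source c
      s<a = ≤∧≢⇒< (c-last (chord s ss)) (λ { refl → x≢ps refl })

    remains′ : Remaining s xs
    remains′ y s<y with remains y s<y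
    ... | inj₁ (here refl)                = inj₂ (¬sx , x≢ps , x<xs)
    ... | inj₁ (there y∈xs)               = inj₁ y∈xs
    ... | inj₂ (¬sy , y≢ps , _ ∷ y<xs)    = inj₂ (¬sy , y≢ps , y<xs)

module _ (n : ℕ) (T : Diagram (suc n)) where

  remaining-Slid : AllPairs (Slid T) (remaining n T)
  remaining-Slid = AllPairs.filter⁺ _ (AllPairs.filter⁺ _ (slide-Slid T (allFin-increasing _)))

  ψ-nonnesting : (oneTerminal : OneTerminal T) → Nonnesting T → Nonnesting (ψ n (T , oneTerminal))
  ψ-nonnesting _ = relabel-nonnesting T (remaining n T) (remaining-length n T)
    (remaining-unique n T) (remaining-closed n T) remaining-Slid

  -- Point `zero` is always a source, so `slide` starts by carrying it with nothing passed yet;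
  -- dropping it gives the shift by one in `Extends`.
  extends-ψ : (oneTerminal : OneTerminal T) → Nonnesting T → Extends T (ψ n (T , oneTerminal))
  extends-ψ oneTerminal nonnesting i (suc j) eq = ⇔.sym (⇔.trans
    (relabel-source T (remaining n T) (remaining-length n T)
      (remaining-unique n T) (remaining-closed n T) remaining-Slid i)
    (Prefix-tabulate prefix _ j (trans (toℕ-cast _ i) (sym (ℕ.suc-injective eq)))))
    where
    zero-source : IsSource T zero
    zero-source = ≤∧≢⇒< z≤n (fixedPointFree T zero ∘ sym)

    c : Chord T
    c = proj₁ (lastChord T)

    SameKind : Fin (2 * suc n) → Fin (2 * suc n) → Set
    SameKind x y = IsSource T x ⇔ IsSource T y

    prefix : Prefix SameKind (remaining n T) (tabulate suc)
    prefix = subst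
      (λ zs → Prefix SameKind (delete (sink c) (delete (source c) zs)) (tabulate suc))
      (sym (slide-source T (tabulate suc) zero-source))
      (carry-prefix T oneTerminal nonnesting c (proj₂ (lastChord T)) zero-source (allFin-increasing _)
        (λ y 0<y → case ∈-allFin y of λ
          { (here refl) → contradiction 0<y λ () ; (there y∈) → inj₁ y∈ }))

-- The inverse of ψ

enumerate : ∀ {k} {P : Pred (Fin k) 0ℓ} → Decidable P →
  Σ[ m ∈ ℕ ] Σ[ s ∈ (Fin m → Fin k) ]
    (∀ {i j} → i < j → s i < s j) × (∀ j → P (s j)) × (∀ {i} → P i → ∃[ j ] s j ≡ i)
enumerate {k} P? =
  length ps , lookup ps ,
  AllPairs-lookup (AllPairs.filter⁺ P? (allFin-increasing k)) ,
  (λ j → proj₂ (∈-filter⁻ P? {xs = allFin k} (∈-lookup j))) ,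
  (λ {i} pi → let i∈ps = ∈-filter⁺ P? (∈-allFin i) pi in index i∈ps , sym (lookup-index i∈ps))
  where
  ps = filter P? (allFin k)

-- Matching the j-th of the increasing sources s with the j-th of the
-- increasing sinks b.
module FirstInFirstOut {m k : ℕ} (s b : Fin m → Fin k)
  (s-increasing : ∀ {i j} → i < j → s i < s j)
  (b-increasing : ∀ {i j} → i < j → b i < b j)
  (s<b : ∀ j → s j < b j)
  (s≢b : ∀ i j → s i ≢ b j)
  (cover : ∀ i → (∃[ j ] s j ≡ i) ⊎ (∃[ j ] b j ≡ i)) where

  private
    increasing-injective : {f : Fin m → Fin k} → (∀ {i j} → i < j → f i < f j) →
      ∀ {i j} → f i ≡ f j → i ≡ j
    increasing-injective f-increasing {i} {j} eq with <-cmp i j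
    ... | tri< i<j _ _ = contradiction (f-increasing i<j) (<-irrefl eq)
    ... | tri≈ _ i≡j _ = i≡j
    ... | tri> _ _ j<i = contradiction (f-increasing j<i) (<-irrefl (sym eq))

    match : ∀ {i} → (∃[ j ] s j ≡ i) ⊎ (∃[ j ] b j ≡ i) → Fin k
    match (inj₁ (j , _)) = b j
    match (inj₂ (j , _)) = s j

    -- Quantifying over `c` makes the partner independent of which witness `cover` returns.
    match-s : ∀ j c → match {s j} c ≡ b j
    match-s j (inj₁ (i , si≡sj)) = cong b (increasing-injective s-increasing si≡sj)
    match-s j (inj₂ (i , bi≡sj)) = contradiction (sym bi≡sj) (s≢b j i)

    match-b : ∀ j c → match {b j} c ≡ s j
    match-b j (inj₁ (i , si≡bj)) = contradiction si≡bj (s≢b i j)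
    match-b j (inj₂ (i , bi≡bj)) = cong s (increasing-injective b-increasing bi≡bj)

    match-involutive : ∀ {i} c → match (cover (match {i} c)) ≡ i
    match-involutive (inj₁ (j , refl)) = match-b j (cover (b j))
    match-involutive (inj₂ (j , refl)) = match-s j (cover (s j))

    match-fixedPointFree : ∀ {i} c → match {i} c ≢ i
    match-fixedPointFree (inj₁ (j , refl)) eq = s≢b j j (sym eq)
    match-fixedPointFree (inj₂ (j , refl)) eq = s≢b j j eq

  matching : PerfectMatching k
  matching = record
    { partner        = λ i → match (cover i)
    ; involutive     = λ i → match-involutive (cover i)
    ; fixedPointFree = λ i → match-fixedPointFree (cover i)
    }

  partner-s : ∀ j → partner matching (s j) ≡ b j
  partner-s j = match-s j (cover (s j))

  partner-b : ∀ j → partner matching (b j) ≡ s j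
  partner-b j = match-b j (cover (b j))

  s-source : ∀ j → IsSource matching (s j)
  s-source j = subst (s j <_) (sym (partner-s j)) (s<b j)

  b-sink : ∀ j → ¬ IsSource matching (b j)
  b-sink j src = <-asym (s<b j) (subst (b j <_) (partner-b j) src)

  chordAt : Fin m → Chord matching
  chordAt j = chord (s j) (s-source j)

  chord-chordAt : ∀ c → ∃[ j ] chordAt j ≡ c
  chord-chordAt (chord i src) = at (cover i) src
    where
    at : ∀ {i} → (∃[ j ] s j ≡ i) ⊎ (∃[ j ] b j ≡ i) → (src : IsSource matching i) →
      ∃[ j ] chordAt j ≡ chord i src
    at (inj₁ (j , refl)) src = j , cong (chord (s j)) (ℕ.≤-irrelevant _ _)
    at (inj₂ (j , refl)) src = contradiction src (b-sink j)

  matching-nonnesting : Nonnesting matching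
  matching-nonnesting c d (c<d , sd<sc) with chord-chordAt c | chord-chordAt d
  ... | i , refl | j , refl with <-cmp i j
  ...   | tri< i<j _ _ = <-asym sd<sc (subst₂ _<_ (sym (partner-s i)) (sym (partner-s j)) (b-increasing i<j))
  ...   | tri≈ _ refl _ = <-irrefl refl c<d
  ...   | tri> _ _ j<i = <-asym c<d (s-increasing j<i)

  chordAt-rightNeighbor : ∀ {i j} → i < j → s j < b i → RightNeighbor (chordAt i) (chordAt j)
  chordAt-rightNeighbor {i} {j} i<j sj<bi =
    s-increasing i<j ,
    subst (s j <_) (sym (partner-s i)) sj<bi ,
    subst₂ _<_ (sym (partner-s i)) (sym (partner-s j)) (b-increasing i<j)

-- The order on `inject₁` and `fromℕ`

inject₁-suc-< : ∀ {m} (i : Fin m) → inject₁ i < suc i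
inject₁-suc-< i = s≤s (ℕ.≤-reflexive (toℕ-inject₁ i))

inject₁-increasing : ∀ {m} {i j : Fin m} → i < j → inject₁ i < inject₁ j
inject₁-increasing {i = i} {j} = subst₂ ℕ._<_ (sym (toℕ-inject₁ i)) (sym (toℕ-inject₁ j))

inject₁-reflects-< : ∀ {m} {i j : Fin m} → inject₁ i < inject₁ j → i < j
inject₁-reflects-< {i = i} {j} = subst₂ ℕ._<_ (toℕ-inject₁ i) (toℕ-inject₁ j)

inject₁<fromℕ : ∀ {m} (i : Fin m) → inject₁ i < fromℕ m
inject₁<fromℕ {m} i = subst₂ ℕ._<_ (sym (toℕ-inject₁ i)) (sym (toℕ-fromℕ m)) (toℕ<n i)

-- Adding a first source and a last sink

module _ {k : ℕ} (D : PerfectMatching k) (nonnesting : Nonnesting D) where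

  private
    m : ℕ
    m = proj₁ (enumerate (isSource? D))

    σ : Fin m → Fin k
    σ = proj₁ (proj₂ (enumerate (isSource? D)))

    σ-increasing : ∀ {i j} → i < j → σ i < σ j
    σ-increasing = proj₁ (proj₂ (proj₂ (enumerate (isSource? D))))

    σ-source : ∀ j → IsSource D (σ j)
    σ-source = proj₁ (proj₂ (proj₂ (proj₂ (enumerate (isSource? D)))))

    source-σ : ∀ {i} → IsSource D i → ∃[ j ] σ j ≡ i
    source-σ = proj₂ (proj₂ (proj₂ (proj₂ (enumerate (isSource? D)))))

    -- An old point `i` becomes `suc (inject₁ i)`; the new points are `zero` and `suc (fromℕ k)`.
    -- The new source comes first and the new sink last, so the `j`-th old chord supplies source
    -- number `suc j` but sink number `inject₁ j`.
    s : Fin (suc m) → Fin (suc (suc k))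
    s zero    = zero
    s (suc j) = suc (inject₁ (σ j))

    b′ : ∀ {j : Fin (suc m)} → View j → Fin (suc k)
    b′ ‵fromℕ       = fromℕ k
    b′ (‵inject₁ j) = inject₁ (partner D (σ j))

    b : Fin (suc m) → Fin (suc (suc k))
    b j = suc (b′ (view j))

    b-inject₁ : ∀ j → b (inject₁ j) ≡ suc (inject₁ (partner D (σ j)))
    b-inject₁ j = cong (suc ∘ b′) (view-inject₁ j)

    s-increasing : ∀ {i j} → i < j → s i < s j
    s-increasing {zero}  {suc j} _         = z<s
    s-increasing {suc i} {suc j} (s≤s i<j) = s≤s (inject₁-increasing (σ-increasing i<j))

    b′-increasing : ∀ {i j} (u : View i) (v : View j) → i < j → b′ u < b′ v
    b′-increasing {j = j} ‵fromℕ _ top<j = contradiction (≤fromℕ j) (ℕ.<⇒≱ top<j)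
    b′-increasing (‵inject₁ i) ‵fromℕ       _   = inject₁<fromℕ (partner D (σ i))
    b′-increasing (‵inject₁ i) (‵inject₁ j) i<j = inject₁-increasing
      (sinks-increasing D nonnesting (σ-source i) (σ-source j) (σ-increasing (inject₁-reflects-< i<j)))

    b-increasing : ∀ {i j} → i < j → b i < b j
    b-increasing {i} {j} i<j = s≤s (b′-increasing (view i) (view j) i<j)

    -- These are the two ends of one chord of `D`. The inequality serves twice: it puts each source
    -- before its new sink, and it makes consecutive new chords cross.
    linked : ∀ j → s (suc j) < b (inject₁ j)
    linked j = subst (s (suc j) <_) (sym (b-inject₁ j)) (s≤s (inject₁-increasing (σ-source j)))

    s<b : ∀ j → s j < b j
    s<b zero    = z<s
    s<b (suc j) = <-trans (linked j) (b-increasing (inject₁-suc-< j))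

    s≢b′ : ∀ i {j} (v : View j) → inject₁ (σ i) ≢ b′ v
    s≢b′ i ‵fromℕ       eq = fromℕ≢inject₁ (sym eq)
    s≢b′ i (‵inject₁ j) eq = partner-of-source D (σ-source j)
      (subst (IsSource D) (inject₁-injective eq) (σ-source i))

    s≢b : ∀ i j → s i ≢ b j
    s≢b (suc i) j eq = s≢b′ i (view j) (suc-injective eq)

    sink-b : ∀ {i} → ¬ IsSource D i → ∃[ j ] b j ≡ suc (inject₁ i)
    sink-b {i} ¬si with source-σ (partner-of-sink D ¬si)
    ... | j , σj≡pi = inject₁ j ,
      trans (b-inject₁ j) (cong (suc ∘ inject₁) (trans (cong (partner D) σj≡pi) (involutive D i)))

    cover : ∀ i → (∃[ j ] s j ≡ i) ⊎ (∃[ j ] b j ≡ i)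
    cover zero = inj₁ (zero , refl)
    cover (suc i) with view i
    ... | ‵fromℕ = inj₂ (fromℕ m , cong (suc ∘ b′) (view-fromℕ m))
    ... | ‵inject₁ i with isSource? D i
    ...   | no ¬si = inj₂ (sink-b ¬si)
    ...   | yes si with source-σ si
    ...     | j , refl = inj₁ (suc j , refl)

  open FirstInFirstOut s b s-increasing b-increasing s<b s≢b cover

  extension : PerfectMatching (suc (suc k))
  extension = matching

  extension-nonnesting : Nonnesting extension
  extension-nonnesting = matching-nonnesting

  extension-extends : Extends extension D
  extension-extends i j eq = subst (λ z → IsSource extension z ⇔ IsSource D i) (sym j≡) (mk⇔ forth back)
    where
    j≡ : j ≡ suc (inject₁ i)
    j≡ = toℕ-injective (trans eq (cong suc (sym (toℕ-inject₁ i))))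

    forth : IsSource extension (suc (inject₁ i)) → IsSource D i
    forth src with isSource? D i
    ... | yes si = si
    ... | no ¬si with sink-b ¬si
    ...   | j , bj≡ = contradiction (subst (IsSource extension) (sym bj≡) src) (b-sink j)

    back : IsSource D i → IsSource extension (suc (inject₁ i))
    back si with source-σ si
    ... | j , refl = s-source (suc j)

  extension-connected : Connected extension
  extension-connected c d with chord-chordAt c | chord-chordAt d
  ... | i , refl | j , refl = reverse swap (from-first i) ◅◅ from-first j
    where
    from-first : ∀ i → Star Cross (chordAt zero) (chordAt i)
    from-first = <-weakInduction (λ i → Star Cross (chordAt zero) (chordAt i)) ε
      (λ i path → path ◅◅ inj₁ (chordAt-rightNeighbor (inject₁-suc-< i) (linked i)) ◅ ε)

-- Assembling the bijection

ExtensionOf : ∀ {k} (l : ℕ) → PerfectMatching k → Set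
ExtensionOf l D = Σ[ T ∈ PerfectMatching l ] Connected T × Nonnesting T × Extends T D

-- The size `l` is a variable because `2 * suc n` is only propositionally equal to
-- `suc (suc (2 * n))`; a variable lets the equation be matched with `refl`.
extend : ∀ {k l} → l ≡ suc (suc k) → (D : PerfectMatching k) → Nonnesting D → ExtensionOf l D
extend refl D nonnesting =
  extension D nonnesting , extension-connected D nonnesting ,
  extension-nonnesting D nonnesting , extension-extends D nonnesting

fromℕ-sink : ∀ {k} (T : PerfectMatching (suc k)) → ¬ IsSource T (fromℕ k)
fromℕ-sink T top<p = ℕ.<⇒≱ top<p (≤fromℕ _)

-- `Extends` settles all letters but the first and the last, and these are the same in every
-- diagram: the first point is a source, the last a sink.
extends⇒source : ∀ {k l} → l ≡ suc (suc k) → {T T′ : PerfectMatching l} {D D′ : PerfectMatching k} →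
  Extends T D → Extends T′ D′ → SameSources D D′ → ∀ j → IsSource T j → IsSource T′ j
extends⇒source refl {T} {T′} ext ext′ same zero _ = ≤∧≢⇒< z≤n (fixedPointFree T′ zero ∘ sym)
extends⇒source refl {T} {T′} ext ext′ same (suc j) src with view j
... | ‵fromℕ     = contradiction src (fromℕ-sink T)
... | ‵inject₁ i = from (ext′ i _ eq) (to (same i) (to (ext i _ eq) src))
  where
  eq : suc (toℕ (inject₁ i)) ≡ suc (toℕ i)
  eq = cong suc (toℕ-inject₁ i)

extends-SameSources : ∀ {k l} → l ≡ suc (suc k) → {T T′ : PerfectMatching l} {D D′ : PerfectMatching k} →
  Extends T D → Extends T′ D′ → SameSources D D′ → SameSources T T′
extends-SameSources l≡ {T} {T′} {D} {D′} ext ext′ same j = mk⇔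
  (extends⇒source l≡ {T} {T′} {D} {D′} ext ext′ same j)
  (extends⇒source l≡ {T′} {T} {D′} {D} ext′ ext (⇔.sym ∘ same) j)

SameSources-extends : ∀ {k l} → l ≡ suc (suc k) → {T T′ : PerfectMatching l} {D D′ : PerfectMatching k} →
  Extends T D → Extends T′ D′ → SameSources T T′ → SameSources D D′
SameSources-extends refl ext ext′ same i =
  ⇔.trans (⇔.sym (ext i _ eq)) (⇔.trans (same (suc (inject₁ i))) (ext′ i _ eq))
  where
  eq : suc (toℕ (inject₁ i)) ≡ suc (toℕ i)
  eq = cong suc (toℕ-inject₁ i)

≈ˢ-isEquivalence : ∀ {k} {P : PerfectMatching k → Set} → IsEquivalence (_≈ˢ_ {P = P})
≈ˢ-isEquivalence = record
  { refl  = λ _ → refl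
  ; sym   = λ D≈E i → sym (D≈E i)
  ; trans = λ D≈E E≈F i → trans (D≈E i) (E≈F i)
  }

corollary8p14 : (n : ℕ) → 2 ≤ suc n →
    Σ[ dom ∈ ((T : Diagram (suc n)) → Connected T → Nonnesting T → OneTerminal T) ]
    Σ[ cod ∈ ((T : Diagram (suc n)) (c : Connected T) (m : Nonnesting T) →
    Nonnesting (ψ n (T , dom T c m))) ]
    IsBijection {A = ConnectedNonnestingDiagram (suc n)} _≈ˢ_ {B = NonnestingDiagram n} _≈ˢ_
    (λ (T , c , m) → ψ n (T , dom T c m) , cod T c m)
corollary8p14 n _ = connected⇒oneTerminal , cod , record
  { isInjection = record
    { isCongruent = record
      { cong           = λ {x} {y} → ψ-cong {x} {y}
      ; isEquivalence₁ = ≈ˢ-isEquivalence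
      ; isEquivalence₂ = ≈ˢ-isEquivalence
      }
    ; injective = λ {x} {y} → ψ-injective {x} {y}
    }
  -- The preimage is the extension of `D`. The image of any `y ≈ T` is nonnesting and has the word
  -- of `T` without its end letters, which is the word of `D`.
  ; surjective = λ (D , nonnesting) →
      let (T , connected , nonnestingT , extends) = extend (ℕ.*-suc 2 n) D nonnesting in
      (T , connected , nonnestingT) , λ {y} y≈T →
        nonnesting-determined (image-nonnesting y) nonnesting
          (SameSources-extends (ℕ.*-suc 2 n) {proj₁ y} {T} {image y} {D}
            (extends-image y) extends (≈⇒SameSources {D = proj₁ y} {T} y≈T))
  }
  where
  cod : (T : Diagram (suc n)) (c : Connected T) (m : Nonnesting T) →
    Nonnesting (ψ n (T , connected⇒oneTerminal T c m))
  cod T c m = ψ-nonnesting n T (connected⇒oneTerminal T c m) m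

  image : ConnectedNonnestingDiagram (suc n) → Diagram n
  image (T , c , m) = ψ n (T , connected⇒oneTerminal T c m)

  image-nonnesting : ∀ x → Nonnesting (image x)
  image-nonnesting (T , c , m) = cod T c m

  extends-image : ∀ x → Extends (proj₁ x) (image x)
  extends-image (T , c , m) = extends-ψ n T (connected⇒oneTerminal T c m) m

  -- Words replace a comparison of the two runs of `slide`: equal words of the diagrams give equal
  -- words of the nonnesting images.
  ψ-cong : ∀ {x y} → proj₁ x ≈ proj₁ y → image x ≈ image y
  ψ-cong {x} {y} x≈y = nonnesting-determined (image-nonnesting x) (image-nonnesting y)
    (SameSources-extends (ℕ.*-suc 2 n) {proj₁ x} {proj₁ y} {image x} {image y}
      (extends-image x) (extends-image y) (≈⇒SameSources {D = proj₁ x} {proj₁ y} x≈y))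

  ψ-injective : ∀ {x y} → image x ≈ image y → proj₁ x ≈ proj₁ y
  ψ-injective {x} {y} eq = nonnesting-determined (proj₂ (proj₂ x)) (proj₂ (proj₂ y))
    (extends-SameSources (ℕ.*-suc 2 n) {proj₁ x} {proj₁ y} {image x} {image y}
      (extends-image x) (extends-image y) (≈⇒SameSources {D = image x} {image y} eq))
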